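{- For all integers $m\ge1$ and $n,h,r\ge0$, $$\mathcal D_{m,r}(n+h,u)=\sum_{k=0}^n\sum_{j=0}^h\binom nk\,\mathcal D_{m,r}(k,u)\,W_{m,r}(h,j)\,u^j\,j^{\,n-k}m^{\,n-k},$$ with the convention $0^0=1$.
   Context: For integers $m\ge1$, $n,k,r\ge0$, $W_{m,r}(n,k)$ denotes the $r$-Whitney number of the second kind, defined by $\sum_{n\ge k}W_{m,r}(n,k)\frac{z^n}{n!}=\frac{e^{rz}}{k!}\left(\frac{e^{mz}-1}{m}\right)^k$ (and $W_{m,r}(n,k)=0$ if $k<0$ or $k>n$). The $r$-Dowling polynomial is $\mathcal D_{m,r}(n,u):=\sum_{k=0}^nW_{m,r}(n,k)u^k$. -}

module Defs where

open import Algebra.Bundles using (CommutativeRing)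
open import Data.Fin.Base using (toℕ)
open import Data.Integer.Base using (+_)
open import Data.Nat.Base as ℕ using (ℕ; zero; suc; _∸_; NonZero; _!)
open import Data.Nat.Properties using (_!≢0)
open import Data.Rational.Base using (ℚ; _/_; _*_; _-_; 0ℚ; 1ℚ)
open import Data.Rational.Properties using (+-*-commutativeRing)
import Algebra.Properties.Semiring.Exp as Exp
import Algebra.Properties.Semiring.Mult as Mult
import Algebra.Properties.Semiring.Sum as Sum

module Series where

  open Sum (CommutativeRing.semiring +-*-commutativeRing)
    using (sum⁺-syntax)

  -- The formal power series ∑ₙ aₙ zⁿ, given by its coefficients n ↦ aₙ.
  PowerSeries : Set
  PowerSeries = ℕ → ℚ

  1ˢ : PowerSeries
  1ˢ zero    = 1ℚ
  1ˢ (suc _) = 0ℚ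

  infixl 6 _-ˢ_
  infixl 7 _*ˢ_ _·ˢ_
  infixr 8 _^ˢ_

  _-ˢ_ : PowerSeries → PowerSeries → PowerSeries
  (f -ˢ g) n = f n - g n

  _·ˢ_ : ℚ → PowerSeries → PowerSeries
  (c ·ˢ f) n = c * f n

  _*ˢ_ : PowerSeries → PowerSeries → PowerSeries
  (f *ˢ g) n = ∑[ i ≤ n ] (f (toℕ i) * g (n ∸ toℕ i))

  _^ˢ_ : PowerSeries → ℕ → PowerSeries
  f ^ˢ zero  = 1ˢ
  f ^ˢ suc k = f *ˢ (f ^ˢ k)

  -- e^{a z} = ∑ₙ aⁿ zⁿ / n!
  exp : ℕ → PowerSeries
  exp a n = (+ (a ℕ.^ n) / n !) {{n !≢0}}

open Series

-- ∑ₙ W_{m,r}(n,k) zⁿ / n!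
whitneyEGF : (m r k : ℕ) .{{_ : NonZero m}} → PowerSeries
whitneyEGF m r k =
  (+ 1 / k !) {{k !≢0}} ·ˢ (exp r *ˢ ((+ 1 / m) ·ˢ (exp m -ˢ 1ˢ)) ^ˢ k)

-- W_{m,r}(n,k).  The convention W_{m,r}(n,k) = 0 for k > n is built in:
-- (e^{mz} - 1)/m has no constant term, so its k-th power starts at z^k.
W : (m r n k : ℕ) .{{_ : NonZero m}} → ℚ
W m r n k = (+ (n !) / 1) * whitneyEGF m r k n

-- The variable u ranges over an arbitrary commutative ℚ-algebra R with
-- structure map ι (e.g. ℚ[u] itself, or any field of characteristic 0).
module Dowling {c ℓ} (R : CommutativeRing c ℓ)
               (ι : ℚ → CommutativeRing.Carrier R) where

  open CommutativeRing R using (Carrier; semiring; 1#) renaming (_*_ to _*ᴿ_)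
  open Exp semiring public using (_^_)
  open Sum semiring public using (sum⁺-syntax)
  open Mult semiring using (_×_)

  ⟦_⟧ : ℕ → Carrier
  ⟦ n ⟧ = n × 1#

  𝓓 : (m r n : ℕ) .{{_ : NonZero m}} → Carrier → Carrier
  𝓓 m r n u = ∑[ k ≤ n ] (ι (W m r n (toℕ k)) *ᴿ u ^ toℕ k)

{-# OPTIONS --safe #-}
-- From d/dz(e^{mz} - 1)/m = e^{mz} one gets the recurrence
--   W(n+1,k) = (r + mk) W(n,k) + W(n,k-1).
-- By it, ∑ⱼ W(h+1,j) uʲ q(j) = ∑ⱼ W(h,j) uʲ ((r + mj) q(j) + u q(j+1)) for every
-- sequence q.  Define p(s,0) = 1 and p(s,n+1) = s p(s,n) + u p(s+m,n).  Taking
-- q(j) = p(r+jm,n) turns the bracket into p(r+jm,n+1), so by induction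
--   ∑ⱼ W(h,j) uʲ p(r+jm,n) = p(r,n+h),
-- and n = 0 identifies p(r,h) with 𝓓(h).  Finally p(r+jm,n) is expanded by
-- p(s+c,n) = ∑ₖ C(n,k) cⁿ⁻ᵏ p(s,k), whose proof uses Pascal's recurrence in the
-- same way.
module Submission where

open import Algebra.Bundles using (CommutativeRing)
open import Algebra.Morphism.Structures using (IsRingHomomorphism)
open import Data.Fin.Base using (Fin; zero; suc; toℕ)
open import Data.Fin.Properties using (toℕ≤pred[n]; toℕ-inject₁; toℕ-fromℕ)
open import Data.Integer.Base as ℤ using (+_)
import Data.Integer.Properties as ℤ
open import Data.Nat.Base as ℕ using (ℕ; zero; suc; pred; _∸_; _≤_; _<_; s≤s; NonZero; _!)
import Data.Nat.Properties as ℕ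
open import Data.Nat.Combinatorics using (_C_; nCk+nC[k+1]≡[n+1]C[k+1]; k>n⇒nCk≡0)
open import Data.Nat.Solver using (module +-*-Solver)
open import Data.Rational.Base as ℚ using (ℚ; 0ℚ; 1ℚ; +-*-rawRing; _/_)
import Data.Rational.Properties as ℚ
import Data.Rational.Unnormalised.Base as ℚᵘ
import Data.Rational.Unnormalised.Properties as ℚᵘ
open import Function.Base using (_∘_)
import Relation.Binary.PropositionalEquality as ≡
open ≡ using (_≡_)
open import Relation.Nullary using (yes; no)
import Algebra.Properties.CommutativeSemiring.Exp as CommExp
import Algebra.Properties.Semiring.Mult as Mult
import Algebra.Properties.Semiring.Sum as Sum
import Algebra.Solver.Ring.NaturalCoefficients.Default as RingSolver
import Relation.Binary.Reasoning.Setoid as SetoidReasoning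
open import Defs

-- Finite sums over a commutative ring.

module SumProperties {c ℓ} (R : CommutativeRing c ℓ) where

  open CommutativeRing R
  open Sum semiring
  open RingSolver commutativeSemiring using (solve; _:+_; _:*_; _:=_)
  open SetoidReasoning setoid

  ∑-cong-≤ : ∀ n {f g : ℕ → Carrier} → (∀ {k} → k ≤ n → f k ≈ g k) →
             ∑[ k ≤ n ] f (toℕ k) ≈ ∑[ k ≤ n ] g (toℕ k)
  ∑-cong-≤ n f≈g = sum-cong-≋ {suc n} (λ i → f≈g (toℕ≤pred[n] i))

  ∑-zero : ∀ n {f : Fin n → Carrier} → (∀ i → f i ≈ 0#) → sum f ≈ 0#
  ∑-zero n f≈0 = trans (sum-cong-≋ f≈0) (sum-replicate-zero n)

  ∑-last : ∀ n (f : ℕ → Carrier) →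
           ∑[ k ≤ suc n ] f (toℕ k) ≈ ∑[ k ≤ n ] f (toℕ k) + f (suc n)
  ∑-last n f = trans (sum-init-last (λ (k : Fin (2 ℕ.+ n)) → f (toℕ k)))
    (+-cong (sum-cong-≋ {suc n} (λ i → reflexive (≡.cong f (toℕ-inject₁ i))))
            (reflexive (≡.cong f (toℕ-fromℕ (suc n)))))

  ∑-linear : ∀ n a b (x y : Fin n → Carrier) →
             ∑[ i < n ] (a * x i + b * y i) ≈ a * sum x + b * sum y
  ∑-linear n a b x y = trans (∑-distrib-+ (λ i → a * x i) (λ i → b * y i))
    (sym (+-cong (*-distribˡ-sum a x) (*-distribˡ-sum b y)))

  -- The recurrence shared by the weighted binomials `pascal` and the Whitney numbers, with a weight
  -- depending on the column only. Its transpose `row-sum` is thus proved once for both.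
  module Triangle
    (a : ℕ → ℕ → Carrier) (w : ℕ → Carrier)
    (a-init : ∀ k → a 0 (suc k) ≈ 0#)
    (a-head : ∀ n → a (suc n) 0 ≈ w 0 * a n 0)
    (a-tail : ∀ n k → a (suc n) (suc k) ≈ w (suc k) * a n (suc k) + a n k)
    where

    above-diagonal : ∀ {n k} → n < k → a n k ≈ 0#
    above-diagonal {zero}  {suc k} _ = a-init k
    above-diagonal {suc n} {suc k} (s≤s n<k) = begin
      a (suc n) (suc k)                  ≈⟨ a-tail n k ⟩
      w (suc k) * a n (suc k) + a n k    ≈⟨ +-cong (*-congˡ (above-diagonal (ℕ.m<n⇒m<1+n n<k))) (above-diagonal n<k) ⟩
      w (suc k) * 0# + 0#                ≈⟨ +-identityʳ _ ⟩
      w (suc k) * 0#                     ≈⟨ zeroʳ _ ⟩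
      0#                                 ∎

    -- Summation by parts: the recurrence splits entry `k` of row `suc n` into a part from column
    -- `k` and one from column `k - 1`. Re-indexing the latter moves the row step onto `q`.
    row-sum : ∀ n (q : ℕ → Carrier) →
      ∑[ k ≤ suc n ] (a (suc n) (toℕ k) * q (toℕ k)) ≈
      ∑[ k ≤ n ] (a n (toℕ k) * (w (toℕ k) * q (toℕ k) + q (suc (toℕ k))))
    row-sum n q = begin
      a (suc n) 0 * q 0 + ∑[ k ≤ n ] (a (suc n) (suc (toℕ k)) * q (suc (toℕ k)))
        ≈⟨ +-cong (*-congʳ (a-head n)) (∑-cong-≤ n λ {k} _ → begin
             a (suc n) (suc k) * q (suc k)
               ≈⟨ *-congʳ (a-tail n k) ⟩
             (w (suc k) * a n (suc k) + a n k) * q (suc k)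
               ≈⟨ distribʳ _ _ _ ⟩
             x (suc k) + y k ∎) ⟩
      x 0 + ∑[ k ≤ n ] (x (suc (toℕ k)) + y (toℕ k))
        ≈⟨ +-congˡ (∑-distrib-+ {suc n} (x ∘ suc ∘ toℕ) (y ∘ toℕ)) ⟩
      x 0 + (∑[ k ≤ n ] x (suc (toℕ k)) + ∑[ k ≤ n ] y (toℕ k))
        ≈⟨ +-assoc _ _ _ ⟨
      ∑[ k ≤ suc n ] x (toℕ k) + ∑[ k ≤ n ] y (toℕ k)
        -- The two sums differ in length; the surplus term `x (suc n)` lies above the diagonal and
        -- vanishes.
        ≈⟨ +-congʳ (∑-last n x) ⟩
      ∑[ k ≤ n ] x (toℕ k) + x (suc n) + ∑[ k ≤ n ] y (toℕ k)
        ≈⟨ +-congʳ (trans (+-congˡ x-last) (+-identityʳ _)) ⟩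
      ∑[ k ≤ n ] x (toℕ k) + ∑[ k ≤ n ] y (toℕ k)
        ≈⟨ ∑-distrib-+ {suc n} (x ∘ toℕ) (y ∘ toℕ) ⟨
      ∑[ k ≤ n ] (x (toℕ k) + y (toℕ k))
        ≈⟨ ∑-cong-≤ n (λ {k} _ → solve 4 (λ w a q q′ → w :* a :* q :+ a :* q′ := a :* (w :* q :+ q′)) refl
             (w k) (a n k) (q k) (q (suc k))) ⟩
      ∑[ k ≤ n ] (a n (toℕ k) * (w (toℕ k) * q (toℕ k) + q (suc (toℕ k)))) ∎
      where
      x y : ℕ → Carrier
      x k = w k * a n k * q k
      y k = a n k * q (suc k)
      x-last : x (suc n) ≈ 0#
      x-last = trans (*-congʳ (trans (*-congˡ (above-diagonal (ℕ.n<1+n n))) (zeroʳ _))) (zeroˡ _)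

-- Fractions of natural numbers in `ℚ`.

module Fractions where

  open import Data.Rational.Base using (_+_; _*_)

  ν : ℕ → ℚ
  ν n = + n / 1

  -- `fromℚᵘ` of `mkℚᵘ (+ a) b` unfolds to `+ a / suc b`, so cross multiplication gives equality
  -- without computing a normal form.
  /-cross : ∀ a b c d .{{_ : NonZero b}} .{{_ : NonZero d}} →
            a ℕ.* d ≡ c ℕ.* b → + a / b ≡ + c / d
  /-cross a (suc b) c (suc d) eq = ℚ.fromℚᵘ-cong {ℚᵘ.mkℚᵘ (+ a) b} {ℚᵘ.mkℚᵘ (+ c) d}
    (ℚᵘ.*≡* (≡.trans (≡.sym (ℤ.pos-* a (suc d))) (≡.trans (≡.cong +_ eq) (ℤ.pos-* c (suc b)))))

  toℚᵘ-/ : ∀ a b → ℚ.toℚᵘ (+ a / suc b) ℚᵘ.≃ ℚᵘ.mkℚᵘ (+ a) b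
  toℚᵘ-/ a b = ℚ.toℚᵘ-fromℚᵘ (ℚᵘ.mkℚᵘ (+ a) b)

  -- `_/_` cancels common factors and does not reduce on variables, so both sides are compared as
  -- unnormalised fractions.
  ν-*-/ : ∀ a c d .{{_ : NonZero d}} → ν a * (+ c / d) ≡ + (a ℕ.* c) / d
  ν-*-/ a c (suc d) = ℚ.toℚᵘ-injective (begin
    ℚ.toℚᵘ (ν a * (+ c / suc d))              ≈⟨ ℚ.toℚᵘ-homo-* (ν a) (+ c / suc d) ⟩
    ℚ.toℚᵘ (ν a) ℚᵘ.* ℚ.toℚᵘ (+ c / suc d)    ≈⟨ ℚᵘ.*-cong (toℚᵘ-/ a 0) (toℚᵘ-/ c d) ⟩
    ℚᵘ.mkℚᵘ (+ a) 0 ℚᵘ.* ℚᵘ.mkℚᵘ (+ c) d      ≈⟨ ℚᵘ.*≡* (≡.cong₂ (λ x y → x ℤ.* + y)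
        (≡.sym (ℤ.pos-* a c)) (≡.sym (ℕ.*-identityˡ (suc d)))) ⟩
    ℚᵘ.mkℚᵘ (+ (a ℕ.* c)) d                   ≈⟨ toℚᵘ-/ (a ℕ.* c) d ⟨
    ℚ.toℚᵘ (+ (a ℕ.* c) / suc d)              ∎)
    where open SetoidReasoning ℚᵘ.≃-setoid

  ν-* : ∀ a b → ν (a ℕ.* b) ≡ ν a * ν b
  ν-* a b = ≡.sym (ν-*-/ a b 1)

  ν-+ : ∀ a b → ν (a ℕ.+ b) ≡ ν a + ν b
  ν-+ a b = ℚ.toℚᵘ-injective (begin
    ℚ.toℚᵘ (ν (a ℕ.+ b))                      ≈⟨ toℚᵘ-/ (a ℕ.+ b) 0 ⟩
    ℚᵘ.mkℚᵘ (+ (a ℕ.+ b)) 0                   ≈⟨ ℚᵘ.*≡* (≡.cong₂ (λ x y → (x ℤ.+ y) ℤ.* + 1)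
        (≡.sym (ℤ.*-identityʳ (+ a))) (≡.sym (ℤ.*-identityʳ (+ b)))) ⟩
    ℚᵘ.mkℚᵘ (+ a) 0 ℚᵘ.+ ℚᵘ.mkℚᵘ (+ b) 0      ≈⟨ ℚᵘ.+-cong (toℚᵘ-/ a 0) (toℚᵘ-/ b 0) ⟨
    ℚ.toℚᵘ (ν a) ℚᵘ.+ ℚ.toℚᵘ (ν b)            ≈⟨ ℚ.toℚᵘ-homo-+ (ν a) (ν b) ⟨
    ℚ.toℚᵘ (ν a + ν b)                        ∎)
    where open SetoidReasoning ℚᵘ.≃-setoid

  ν-inverseʳ : ∀ m .{{_ : NonZero m}} → ν m * (+ 1 / m) ≡ 1ℚ
  ν-inverseʳ m = ≡.trans (ν-*-/ m 1 m) (/-cross (m ℕ.* 1) m 1 1 (≡.trans (ℕ.*-identityʳ _) (ℕ.*-comm m 1)))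

open Fractions

-- Formal derivatives of power series.

module SeriesProperties where

  open Series
  open CommutativeRing ℚ.+-*-commutativeRing using (commutativeSemiring; semiring)
  open Sum semiring
  open SumProperties ℚ.+-*-commutativeRing
  open RingSolver commutativeSemiring using (solve; con; _:+_; _:*_; _:=_)
  open import Data.Rational.Base using (_+_; _*_)
  open ≡
  open ≡-Reasoning

  -- The formal derivative d/dz.
  D : PowerSeries → PowerSeries
  D f n = ν (suc n) * f (suc n)

  -- The factor `suc n` is split as `i + (suc n ∸ i)`, one summand for each factor of the product.
  -- The first sum loses its term at `i = 0`, the second its term at `i = suc n`; the two
  -- convolutions remain.
  Leibniz : ∀ f g n → D (f *ˢ g) n ≡ (D f *ˢ g) n + (f *ˢ D g) n
  Leibniz f g n = begin
    ν (suc n) * ∑[ i ≤ suc n ] (f (toℕ i) * g (suc n ∸ toℕ i))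
      ≡⟨ *-distribˡ-sum {2 ℕ.+ n} (ν (suc n)) (λ i → f (toℕ i) * g (suc n ∸ toℕ i)) ⟩
    ∑[ i ≤ suc n ] (ν (suc n) * (f (toℕ i) * g (suc n ∸ toℕ i)))
      ≡⟨ ∑-cong-≤ (suc n) split ⟩
    ∑[ i ≤ suc n ] (x (toℕ i) + y (toℕ i))
      ≡⟨ ∑-distrib-+ {2 ℕ.+ n} (x ∘ toℕ) (y ∘ toℕ) ⟩
    ∑[ i ≤ suc n ] x (toℕ i) + ∑[ i ≤ suc n ] y (toℕ i)
      ≡⟨ cong₂ _+_ x-head y-last ⟩
    (D f *ˢ g) n + (f *ˢ D g) n ∎
    where
    x y : ℕ → ℚ
    x i = ν i * f i * g (suc n ∸ i)
    y i = f i * (ν (suc n ∸ i) * g (suc n ∸ i))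

    split : ∀ {i} → i ≤ suc n → ν (suc n) * (f i * g (suc n ∸ i)) ≡ x i + y i
    split {i} i≤1+n = begin
      ν (suc n) * (f i * g (suc n ∸ i))
        ≡⟨ cong (λ t → ν t * (f i * g (suc n ∸ i))) (ℕ.m+[n∸m]≡n i≤1+n) ⟨
      ν (i ℕ.+ (suc n ∸ i)) * (f i * g (suc n ∸ i))
        ≡⟨ cong (_* (f i * g (suc n ∸ i))) (ν-+ i (suc n ∸ i)) ⟩
      (ν i + ν (suc n ∸ i)) * (f i * g (suc n ∸ i))
        ≡⟨ solve 4 (λ a b f g → (a :+ b) :* (f :* g) := a :* f :* g :+ f :* (b :* g)) refl
             (ν i) (ν (suc n ∸ i)) (f i) (g (suc n ∸ i)) ⟩
      x i + y i ∎

    x-head : ∑[ i ≤ suc n ] x (toℕ i) ≡ (D f *ˢ g) n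
    x-head = trans
      (cong (_+ ∑[ i ≤ n ] x (suc (toℕ i))) (solve 2 (λ f g → con 0 :* f :* g := con 0) refl (f 0) (g (suc n))))
      (ℚ.+-identityˡ _)

    y-last : ∑[ i ≤ suc n ] y (toℕ i) ≡ (f *ˢ D g) n
    y-last = begin
      ∑[ i ≤ suc n ] y (toℕ i)         ≡⟨ ∑-last n y ⟩
      ∑[ i ≤ n ] y (toℕ i) + y (suc n)
        ≡⟨ cong₂ _+_
             -- For `i ≤ n`, `suc n ∸ i` equals `suc (n ∸ i)`, the index at which `D g` reads `g`.
             (∑-cong-≤ n λ {i} i≤n → cong (λ t → f i * (ν t * g t)) (ℕ.+-∸-assoc 1 i≤n))
             (trans (cong (λ t → f (suc n) * (ν t * g t)) (ℕ.n∸n≡0 n))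
                    (solve 2 (λ f g → f :* (con 0 :* g) := con 0) refl (f (suc n)) (g 0))) ⟩
      (f *ˢ D g) n + 0ℚ                ≡⟨ ℚ.+-identityʳ _ ⟩
      (f *ˢ D g) n                     ∎

  -- The decomposition of `f` is a pointwise hypothesis: equality of series as functions would call
  -- for function extensionality.
  *ˢ-linearˡ : ∀ a b {f₁ f₂ f : PowerSeries} g → (∀ n → f n ≡ a * f₁ n + b * f₂ n) →
               ∀ n → (f *ˢ g) n ≡ a * (f₁ *ˢ g) n + b * (f₂ *ˢ g) n
  *ˢ-linearˡ a b {f₁} {f₂} {f} g eq n = trans
    (∑-cong-≤ n λ {i} _ → trans (cong (_* g (n ∸ i)) (eq i))
      (solve 5 (λ a b x y z → (a :* x :+ b :* y) :* z := a :* (x :* z) :+ b :* (y :* z)) refl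
        a b (f₁ i) (f₂ i) (g (n ∸ i))))
    (∑-linear (suc n) a b (λ i → f₁ (toℕ i) * g (n ∸ toℕ i)) (λ i → f₂ (toℕ i) * g (n ∸ toℕ i)))

  *ˢ-linearʳ : ∀ a b f {g₁ g₂ g : PowerSeries} → (∀ n → g n ≡ a * g₁ n + b * g₂ n) →
               ∀ n → (f *ˢ g) n ≡ a * (f *ˢ g₁) n + b * (f *ˢ g₂) n
  *ˢ-linearʳ a b f {g₁} {g₂} {g} eq n = trans
    (∑-cong-≤ n λ {i} _ → trans (cong (f i *_) (eq (n ∸ i)))
      (solve 5 (λ a b x y z → z :* (a :* x :+ b :* y) := a :* (z :* x) :+ b :* (z :* y)) refl
        a b (g₁ (n ∸ i)) (g₂ (n ∸ i)) (f i)))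
    (∑-linear (suc n) a b (λ i → f (toℕ i) * g₁ (n ∸ toℕ i)) (λ i → f (toℕ i) * g₂ (n ∸ toℕ i)))

  *ˢ-identityˡ : ∀ f n → (1ˢ *ˢ f) n ≡ f n
  *ˢ-identityˡ f n = trans
    (cong₂ _+_ (ℚ.*-identityˡ (f n)) (∑-zero n (λ i → ℚ.*-zeroˡ (f (n ∸ toℕ (suc i))))))
    (ℚ.+-identityʳ (f n))

  *ˢ-constant : ∀ f g → (f *ˢ g) 0 ≡ f 0 * g 0
  *ˢ-constant f g = ℚ.+-identityʳ (f 0 * g 0)

  D-exp : ∀ a n → D (exp a) n ≡ ν a * exp a n
  D-exp a n = begin
    ν (suc n) * exp a (suc n)
      ≡⟨ ν-*-/ (suc n) (a ℕ.^ suc n) (suc n !) {{suc n ℕ.!≢0}} ⟩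
    (+ (suc n ℕ.* (a ℕ.* a ℕ.^ n)) / (suc n !)) {{suc n ℕ.!≢0}}
      ≡⟨ /-cross (suc n ℕ.* (a ℕ.* a ℕ.^ n)) (suc n !) (a ℕ.* a ℕ.^ n) (n !) {{suc n ℕ.!≢0}} {{n ℕ.!≢0}}
           (NS.solve 4 (λ s a b f → (s NS.:* (a NS.:* b)) NS.:* f NS.:= (a NS.:* b) NS.:* (s NS.:* f)) refl
             (suc n) a (a ℕ.^ n) (n !)) ⟩
    (+ (a ℕ.* a ℕ.^ n) / (n !)) {{n ℕ.!≢0}}
      ≡⟨ ν-*-/ a (a ℕ.^ n) (n !) {{n ℕ.!≢0}} ⟨
    ν a * exp a n ∎
    where module NS = +-*-Solver

  -- Recurrence of the Whitney numbers from their generating functions.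

  module WhitneySeries (m r : ℕ) .{{_ : NonZero m}} where

    E : PowerSeries
    E = (+ 1 / m) ·ˢ (exp m -ˢ 1ˢ)

    -- This is `k !` times the generating function of column `k`; the factor `1/ k !` returns when
    -- the recurrence is read off.
    G : ℕ → PowerSeries
    G k = exp r *ˢ E ^ˢ k

    exp≡mE+1 : ∀ n → exp m n ≡ ν m * E n + 1ℚ * 1ˢ n
    exp≡mE+1 n = begin
      exp m n
        ≡⟨ ℚ.+-identityʳ _ ⟨
      exp m n + 0ℚ
        ≡⟨ cong (λ t → exp m n + t) (ℚ.+-inverseˡ (1ˢ n)) ⟨
      exp m n + (ℚ.- 1ˢ n + 1ˢ n)
        -- The solver treats semirings only, so the negation enters as an atom `o′`, and the
        -- cancelling pair is inserted beforehand.
        ≡⟨ solve 3 (λ e o o′ → e :+ (o′ :+ o) := con 1 :* (e :+ o′) :+ con 1 :* o) refl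
             (exp m n) (1ˢ n) (ℚ.- 1ˢ n) ⟩
      1ℚ * (exp m -ˢ 1ˢ) n + 1ℚ * 1ˢ n
        ≡⟨ cong (λ t → t * (exp m -ˢ 1ˢ) n + 1ℚ * 1ˢ n) (ν-inverseʳ m) ⟨
      ν m * (+ 1 / m) * (exp m -ˢ 1ˢ) n + 1ℚ * 1ˢ n
        ≡⟨ cong (_+ 1ℚ * 1ˢ n) (ℚ.*-assoc (ν m) (+ 1 / m) ((exp m -ˢ 1ˢ) n)) ⟩
      ν m * E n + 1ℚ * 1ˢ n ∎

    -- The derivative of `E` is `exp m`. Writing it through `E` and `1ˢ` keeps the derivatives of
    -- powers of `E` among combinations of such powers.
    D-E : ∀ n → D E n ≡ ν m * E n + 1ℚ * 1ˢ n
    D-E n = begin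
      ν (suc n) * ((+ 1 / m) * (exp m (suc n) + 0ℚ))
        ≡⟨ solve 3 (λ s i e → s :* (i :* (e :+ con 0)) := i :* (s :* e)) refl
             (ν (suc n)) (+ 1 / m) (exp m (suc n)) ⟩
      (+ 1 / m) * D (exp m) n
        ≡⟨ cong ((+ 1 / m) *_) (D-exp m n) ⟩
      (+ 1 / m) * (ν m * exp m n)
        ≡⟨ solve 3 (λ i m e → i :* (m :* e) := m :* i :* e) refl (+ 1 / m) (ν m) (exp m n) ⟩
      ν m * (+ 1 / m) * exp m n
        ≡⟨ cong (_* exp m n) (ν-inverseʳ m) ⟩
      1ℚ * exp m n
        ≡⟨ ℚ.*-identityˡ _ ⟩
      exp m n
        ≡⟨ exp≡mE+1 n ⟩
      ν m * E n + 1ℚ * 1ˢ n ∎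

    -- This is `k E^(k-1) E'` with `E' = m E + 1`. At `k = 0` the default `pred 0 = 0` is multiplied
    -- by `ν 0`.
    D-E^ : ∀ k n → D (E ^ˢ k) n ≡ ν k * ν m * (E ^ˢ k) n + ν k * (E ^ˢ pred k) n
    D-E^ zero    n = solve 4 (λ s m a b → s :* con 0 := con 0 :* m :* a :+ con 0 :* b) refl
      (ν (suc n)) (ν m) (1ˢ n) (1ˢ n)
    D-E^ (suc k) n = begin
      D (E *ˢ E ^ˢ k) n
        ≡⟨ Leibniz E (E ^ˢ k) n ⟩
      (D E *ˢ E ^ˢ k) n + (E *ˢ D (E ^ˢ k)) n
        ≡⟨ cong₂ _+_
             (*ˢ-linearˡ (ν m) 1ℚ {E} {1ˢ} (E ^ˢ k) D-E n)
             (*ˢ-linearʳ (ν k * ν m) (ν k) E {E ^ˢ k} {E ^ˢ pred k} (D-E^ k) n) ⟩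
      (ν m * P + 1ℚ * (1ˢ *ˢ E ^ˢ k) n) + (ν k * ν m * P + ν k * (E *ˢ E ^ˢ pred k) n)
        ≡⟨ cong₂ (λ x y → (ν m * P + 1ℚ * x) + (ν k * ν m * P + y)) (*ˢ-identityˡ (E ^ˢ k) n) (lower k) ⟩
      (ν m * P + 1ℚ * Q) + (ν k * ν m * P + ν k * Q)
        ≡⟨ solve 4 (λ k m p q → (m :* p :+ con 1 :* q) :+ (k :* m :* p :+ k :* q)
                              := (con 1 :+ k) :* m :* p :+ (con 1 :+ k) :* q) refl (ν k) (ν m) P Q ⟩
      (1ℚ + ν k) * ν m * P + (1ℚ + ν k) * Q
        ≡⟨ cong (λ t → t * ν m * P + t * Q) (ν-+ 1 k) ⟨
      ν (suc k) * ν m * P + ν (suc k) * Q ∎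
      where
      P Q : ℚ
      P = (E ^ˢ suc k) n
      Q = (E ^ˢ k) n
      -- Multiplying `E ^ˢ pred k` by `E` restores `E ^ˢ k` only for positive `k`; at `k = 0` the
      -- factor `ν 0` annihilates both sides.
      lower : ∀ k → ν k * (E *ˢ E ^ˢ pred k) n ≡ ν k * (E ^ˢ k) n
      lower zero    = trans (ℚ.*-zeroˡ ((E *ˢ 1ˢ) n)) (sym (ℚ.*-zeroˡ (1ˢ n)))
      lower (suc k) = refl

    -- By the product rule, `exp r` contributes the summand `ν r` of the weight and `E ^ˢ k` the
    -- rest.
    D-G : ∀ k n → D (G k) n ≡ (ν r + ν k * ν m) * G k n + ν k * G (pred k) n
    D-G k n = begin
      D (G k) n
        ≡⟨ Leibniz (exp r) (E ^ˢ k) n ⟩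
      (D (exp r) *ˢ E ^ˢ k) n + (exp r *ˢ D (E ^ˢ k)) n
        ≡⟨ cong₂ _+_
             -- `D (exp r)` is a single multiple; the summand with coefficient `0ℚ` fits it to the
             -- two-term linearity lemma.
             (*ˢ-linearˡ (ν r) 0ℚ {exp r} {exp r} (E ^ˢ k)
               (λ i → trans (D-exp r i) (solve 2 (λ r e → r :* e := r :* e :+ con 0 :* e) refl (ν r) (exp r i))) n)
             (*ˢ-linearʳ (ν k * ν m) (ν k) (exp r) {E ^ˢ k} {E ^ˢ pred k} (D-E^ k) n) ⟩
      (ν r * G k n + 0ℚ * G k n) + (ν k * ν m * G k n + ν k * G (pred k) n)
        ≡⟨ solve 5 (λ r k m g h → (r :* g :+ con 0 :* g) :+ (k :* m :* g :+ k :* h)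
                                := (r :+ k :* m) :* g :+ k :* h) refl (ν r) (ν k) (ν m) (G k n) (G (pred k) n) ⟩
      (ν r + ν k * ν m) * G k n + ν k * G (pred k) n ∎

    1/_! : ℕ → ℚ
    1/ k ! = (+ 1 / k !) {{k ℕ.!≢0}}

    -- Turns the factor `ν (suc k)` from `D-G` into the normalisation of column `k`.
    1/[1+k]!*[1+k] : ∀ k → 1/ suc k ! * ν (suc k) ≡ 1/ k !
    1/[1+k]!*[1+k] k = begin
      1/ suc k ! * ν (suc k)
        ≡⟨ ℚ.*-comm (1/ suc k !) (ν (suc k)) ⟩
      ν (suc k) * 1/ suc k !
        ≡⟨ ν-*-/ (suc k) 1 (suc k !) {{suc k ℕ.!≢0}} ⟩
      (+ (suc k ℕ.* 1) / (suc k !)) {{suc k ℕ.!≢0}}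
        ≡⟨ /-cross (suc k ℕ.* 1) (suc k !) 1 (k !) {{suc k ℕ.!≢0}} {{k ℕ.!≢0}}
             (NS.solve 2 (λ s f → s NS.:* NS.con 1 NS.:* f NS.:= NS.con 1 NS.:* (s NS.:* f)) refl (suc k) (k !)) ⟩
      1/ k ! ∎
      where module NS = +-*-Solver

    -- Differentiation shifts an exponential generating function: the factor `suc n` of `suc n !` is
    -- the one in `D`.
    W-derivative : ∀ n k → W m r (suc n) k ≡ ν (n !) * (1/ k ! * D (G k) n)
    W-derivative n k = begin
      ν (suc n ℕ.* n !) * (1/ k ! * G k (suc n))
        ≡⟨ cong (_* (1/ k ! * G k (suc n))) (ν-* (suc n) (n !)) ⟩
      ν (suc n) * ν (n !) * (1/ k ! * G k (suc n))
        ≡⟨ solve 4 (λ a b c d → a :* b :* (c :* d) := b :* (c :* (a :* d))) refl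
             (ν (suc n)) (ν (n !)) (1/ k !) (G k (suc n)) ⟩
      ν (n !) * (1/ k ! * D (G k) n) ∎

    -- In column 0 the lower term of `D-G` carries the factor `ν 0`, so just the weighted term
    -- survives.
    W-suc-zero : ∀ n → W m r (suc n) 0 ≡ (ν r + ν 0 * ν m) * W m r n 0
    W-suc-zero n = begin
      W m r (suc n) 0
        ≡⟨ W-derivative n 0 ⟩
      ν (n !) * (1/ 0 ! * D (G 0) n)
        ≡⟨ cong (λ t → ν (n !) * (1/ 0 ! * t)) (D-G 0 n) ⟩
      ν (n !) * (1/ 0 ! * ((ν r + 0ℚ * ν m) * G 0 n + 0ℚ * G 0 n))
        ≡⟨ solve 5 (λ f i r m g → f :* (i :* ((r :+ con 0 :* m) :* g :+ con 0 :* g))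
                               := (r :+ con 0 :* m) :* (f :* (i :* g))) refl
             (ν (n !)) (1/ 0 !) (ν r) (ν m) (G 0 n) ⟩
      (ν r + ν 0 * ν m) * W m r n 0 ∎

    W-suc-suc : ∀ n k → W m r (suc n) (suc k) ≡
                (ν r + ν (suc k) * ν m) * W m r n (suc k) + W m r n k
    W-suc-suc n k = begin
      W m r (suc n) (suc k)
        ≡⟨ W-derivative n (suc k) ⟩
      ν (n !) * (1/ suc k ! * D (G (suc k)) n)
        ≡⟨ cong (λ t → ν (n !) * (1/ suc k ! * t)) (D-G (suc k) n) ⟩
      ν (n !) * (1/ suc k ! * (A * G (suc k) n + ν (suc k) * G k n))
        ≡⟨ solve 6 (λ f i a g s h → f :* (i :* (a :* g :+ s :* h))
                                  := a :* (f :* (i :* g)) :+ f :* (i :* s :* h)) refl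
             (ν (n !)) (1/ suc k !) A (G (suc k) n) (ν (suc k)) (G k n) ⟩
      A * W m r n (suc k) + ν (n !) * (1/ suc k ! * ν (suc k) * G k n)
        ≡⟨ cong (λ t → A * W m r n (suc k) + ν (n !) * (t * G k n)) (1/[1+k]!*[1+k] k) ⟩
      A * W m r n (suc k) + W m r n k ∎
      where
      A : ℚ
      A = ν r + ν (suc k) * ν m

    W-zero-zero : W m r 0 0 ≡ 1ℚ
    W-zero-zero = refl

    -- `exp m` and `1ˢ` agree at 0, so the constant term of a positive power of `E` has a zero
    -- factor.
    W-zero-suc : ∀ k → W m r 0 (suc k) ≡ 0ℚ
    W-zero-suc k = begin
      1ℚ * (1/ suc k ! * (exp r *ˢ E ^ˢ suc k) 0)
        ≡⟨ cong (λ t → 1ℚ * (1/ suc k ! * t)) (*ˢ-constant (exp r) (E ^ˢ suc k)) ⟩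
      1ℚ * (1/ suc k ! * (1ℚ * (E *ˢ E ^ˢ k) 0))
        ≡⟨ cong (λ t → 1ℚ * (1/ suc k ! * (1ℚ * t))) (*ˢ-constant E (E ^ˢ k)) ⟩
      1ℚ * (1/ suc k ! * (1ℚ * ((+ 1 / m) * 0ℚ * (E ^ˢ k) 0)))
        ≡⟨ solve 3 (λ a b c → con 1 :* (a :* (con 1 :* (b :* con 0 :* c))) := con 0) refl
             (1/ suc k !) (+ 1 / m) ((E ^ˢ k) 0) ⟩
      0ℚ ∎

-- The polynomials `p` over the algebra `R`.

module Umbral {c ℓ} (R : CommutativeRing c ℓ) (ι : ℚ → CommutativeRing.Carrier R)
              (ι-hom : IsRingHomomorphism +-*-rawRing (CommutativeRing.rawRing R) ι)
              (u : CommutativeRing.Carrier R) (m : ℕ) .{{_ : NonZero m}} where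

  open CommutativeRing R
  open Dowling R ι
  open Sum semiring using (∑-comm; *-distribˡ-sum)
  open Mult semiring using (×-homo-+)
  open SumProperties R
  open RingSolver commutativeSemiring using (solve; con; _:+_; _:*_; _:=_)
  open SetoidReasoning setoid
  module ι = IsRingHomomorphism ι-hom

  -- Links the two images of a natural number in `R`: through `ℚ`, as in the recurrence of `W`, and
  -- as a multiple of `1#`, as in the addition formula.
  ι-ν : ∀ n → ι (ν n) ≈ ⟦ n ⟧
  ι-ν zero    = ι.0#-homo
  ι-ν (suc n) = begin
    ι (ν (suc n))      ≈⟨ ι.⟦⟧-cong (ν-+ 1 n) ⟩
    ι (1ℚ ℚ.+ ν n)     ≈⟨ ι.+-homo 1ℚ (ν n) ⟩
    ι 1ℚ + ι (ν n)     ≈⟨ +-cong ι.1#-homo (ι-ν n) ⟩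
    1# + ⟦ n ⟧         ∎

  -- p (r + jm) n is 𝓓_{m,r+jm}(n,u).
  p : Carrier → ℕ → Carrier
  p s zero    = 1#
  p s (suc n) = s * p s n + u * p (s + ⟦ m ⟧) n

  p-cong : ∀ n {s t} → s ≈ t → p s n ≈ p t n
  p-cong zero    _   = refl
  p-cong (suc n) s≈t = +-cong (*-cong s≈t (p-cong n s≈t)) (*-congˡ (p-cong n (+-congʳ s≈t)))

  -- Binomial expansion of `p` in its first argument.

  module _ (c : Carrier) where

    pascal : ℕ → ℕ → Carrier
    pascal n k = ⟦ n C k ⟧ * c ^ (n ∸ k)

    pascal-tail : ∀ n k → pascal (suc n) (suc k) ≈ c * pascal n (suc k) + pascal n k
    pascal-tail n k = begin
      ⟦ suc n C suc k ⟧ * c ^ (n ∸ k)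
        ≈⟨ *-congʳ (reflexive (≡.cong ⟦_⟧ (nCk+nC[k+1]≡[n+1]C[k+1] n k))) ⟨
      ⟦ n C k ℕ.+ n C suc k ⟧ * c ^ (n ∸ k)
        ≈⟨ *-congʳ (×-homo-+ 1# (n C k) (n C suc k)) ⟩
      (⟦ n C k ⟧ + ⟦ n C suc k ⟧) * c ^ (n ∸ k)
        ≈⟨ solve 3 (λ a b x → (a :+ b) :* x := b :* x :+ a :* x) refl ⟦ n C k ⟧ ⟦ n C suc k ⟧ (c ^ (n ∸ k)) ⟩
      ⟦ n C suc k ⟧ * c ^ (n ∸ k) + pascal n k
        ≈⟨ +-congʳ shift ⟩
      c * pascal n (suc k) + pascal n k ∎
      where
      shift : ⟦ n C suc k ⟧ * c ^ (n ∸ k) ≈ c * pascal n (suc k)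
      shift with k ℕ.<? n
      ... | yes k<n = trans
        (*-congˡ (reflexive (≡.cong (c ^_) (ℕ.+-∸-assoc 1 k<n))))
        (solve 3 (λ a b x → a :* (b :* x) := b :* (a :* x)) refl ⟦ n C suc k ⟧ c (c ^ (n ∸ suc k)))
      -- For `k ≥ n` both truncated exponents are 0, so no factor `c` can be split off; instead
      -- `n C suc k` vanishes on both sides.
      ... | no k≮n = begin
        ⟦ n C suc k ⟧ * c ^ (n ∸ k)    ≈⟨ *-congʳ vanish ⟩
        0# * c ^ (n ∸ k)               ≈⟨ solve 3 (λ c x y → con 0 :* x := c :* (con 0 :* y)) refl
                                             c (c ^ (n ∸ k)) (c ^ (n ∸ suc k)) ⟩
        c * (0# * c ^ (n ∸ suc k))     ≈⟨ *-congˡ (*-congʳ vanish) ⟨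
        c * pascal n (suc k)           ∎
        where
        vanish : ⟦ n C suc k ⟧ ≈ 0#
        vanish = reflexive (≡.cong ⟦_⟧ (k>n⇒nCk≡0 (s≤s (ℕ.≮⇒≥ k≮n))))

    private module Pascal = Triangle pascal (λ _ → c)
              (λ _ → zeroˡ _)
              (λ n → solve 3 (λ a b x → a :* (b :* x) := b :* (a :* x)) refl ⟦ 1 ⟧ c (c ^ n))
              pascal-tail

    -- `row-sum` leaves `c * p s k + p s (suc k)`, which the recurrence of `p` makes
    -- `(s + c) * p s k + u * p (s + ⟦ m ⟧) k`. The induction hypothesis then serves at `s` and at
    -- `s + ⟦ m ⟧`, so the induction on `n` is for all `s`.
    p-shift : ∀ n s → ∑[ k ≤ n ] (pascal n (toℕ k) * p s (toℕ k)) ≈ p (s + c) n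
    p-shift zero    s = solve 0 (((con 1 :+ con 0) :* con 1) :* con 1 :+ con 0 := con 1) refl
    p-shift (suc n) s = begin
      ∑[ k ≤ suc n ] (pascal (suc n) (toℕ k) * p s (toℕ k))
        ≈⟨ Pascal.row-sum n (p s) ⟩
      ∑[ k ≤ n ] (pascal n (toℕ k) * (c * p s (toℕ k) + p s (suc (toℕ k))))
        ≈⟨ ∑-cong-≤ n (λ {k} _ → solve 6 (λ a c p s u q → a :* (c :* p :+ (s :* p :+ u :* q))
                                      := (s :+ c) :* (a :* p) :+ u :* (a :* q)) refl
             (pascal n k) c (p s k) s u (p (s + ⟦ m ⟧) k)) ⟩
      ∑[ k ≤ n ] ((s + c) * (pascal n (toℕ k) * p s (toℕ k)) + u * (pascal n (toℕ k) * p (s + ⟦ m ⟧) (toℕ k)))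
        ≈⟨ ∑-linear (suc n) (s + c) u (λ k → pascal n (toℕ k) * p s (toℕ k))
             (λ k → pascal n (toℕ k) * p (s + ⟦ m ⟧) (toℕ k)) ⟩
      (s + c) * ∑[ k ≤ n ] (pascal n (toℕ k) * p s (toℕ k)) + u * ∑[ k ≤ n ] (pascal n (toℕ k) * p (s + ⟦ m ⟧) (toℕ k))
        ≈⟨ +-cong (*-congˡ (p-shift n s)) (*-congˡ (p-shift n (s + ⟦ m ⟧))) ⟩
      (s + c) * p (s + c) n + u * p (s + ⟦ m ⟧ + c) n
        -- The two shifts of `s` commute, which gives the recurrence of `p` at `s + c`.
        ≈⟨ +-congˡ (*-congˡ (p-cong n (solve 3 (λ s m c → s :+ m :+ c := s :+ c :+ m) refl s ⟦ m ⟧ c))) ⟩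
      p (s + c) (suc n) ∎

  -- Whitney sums of `p` and the addition formula.

  module _ (r : ℕ) where

    open SeriesProperties.WhitneySeries m r

    private
      w : ℕ → Carrier
      w k = ⟦ r ⟧ + ⟦ k ⟧ * ⟦ m ⟧

      ι-w : ∀ k → ι (ν r ℚ.+ ν k ℚ.* ν m) ≈ w k
      ι-w k = begin
        ι (ν r ℚ.+ ν k ℚ.* ν m)        ≈⟨ ι.+-homo _ _ ⟩
        ι (ν r) + ι (ν k ℚ.* ν m)      ≈⟨ +-congˡ (ι.*-homo _ _) ⟩
        ι (ν r) + ι (ν k) * ι (ν m)    ≈⟨ +-cong (ι-ν r) (*-cong (ι-ν k) (ι-ν m)) ⟩
        w k                            ∎

      module Whitney = Triangle (λ n k → ι (W m r n k)) w
        (λ k → trans (ι.⟦⟧-cong (W-zero-suc k)) ι.0#-homo)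
        (λ n → begin
          ι (W m r (suc n) 0)                              ≈⟨ ι.⟦⟧-cong (W-suc-zero n) ⟩
          ι ((ν r ℚ.+ ν 0 ℚ.* ν m) ℚ.* W m r n 0)          ≈⟨ ι.*-homo _ _ ⟩
          ι (ν r ℚ.+ ν 0 ℚ.* ν m) * ι (W m r n 0)          ≈⟨ *-congʳ (ι-w 0) ⟩
          w 0 * ι (W m r n 0)                              ∎)
        (λ n k → begin
          ι (W m r (suc n) (suc k))
            ≈⟨ ι.⟦⟧-cong (W-suc-suc n k) ⟩
          ι ((ν r ℚ.+ ν (suc k) ℚ.* ν m) ℚ.* W m r n (suc k) ℚ.+ W m r n k)
            ≈⟨ ι.+-homo _ _ ⟩
          ι ((ν r ℚ.+ ν (suc k) ℚ.* ν m) ℚ.* W m r n (suc k)) + ι (W m r n k)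
            ≈⟨ +-congʳ (ι.*-homo _ _) ⟩
          ι (ν r ℚ.+ ν (suc k) ℚ.* ν m) * ι (W m r n (suc k)) + ι (W m r n k)
            ≈⟨ +-congʳ (*-congʳ (ι-w (suc k))) ⟩
          w (suc k) * ι (W m r n (suc k)) + ι (W m r n k) ∎)

    -- Induction on `h` for all `n`: each row removed from the Whitney triangle raises the second
    -- argument of `p` by one, so `h + n` is preserved.
    Whitney-sum : ∀ h n →
      ∑[ j ≤ h ] (ι (W m r h (toℕ j)) * (u ^ toℕ j * p (w (toℕ j)) n)) ≈ p ⟦ r ⟧ (h ℕ.+ n)
    Whitney-sum zero n = begin
      ι (W m r 0 0) * (1# * p (w 0) n) + 0#
        ≈⟨ +-congʳ (*-cong (trans (ι.⟦⟧-cong W-zero-zero) ι.1#-homo)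
             (*-congˡ (p-cong n (solve 2 (λ r m → r :+ con 0 :* m := r) refl ⟦ r ⟧ ⟦ m ⟧)))) ⟩
      1# * (1# * p ⟦ r ⟧ n) + 0#
        ≈⟨ solve 1 (λ p → con 1 :* (con 1 :* p) :+ con 0 := p) refl (p ⟦ r ⟧ n) ⟩
      p ⟦ r ⟧ n ∎
    Whitney-sum (suc h) n = begin
      ∑[ j ≤ suc h ] (ι (W m r (suc h) (toℕ j)) * q n (toℕ j))
        ≈⟨ Whitney.row-sum h (q n) ⟩
      ∑[ j ≤ h ] (ι (W m r h (toℕ j)) * (w (toℕ j) * q n (toℕ j) + q n (suc (toℕ j))))
        ≈⟨ ∑-cong-≤ h (λ {j} _ → *-congˡ {ι (W m r h j)} (q-suc j)) ⟩
      ∑[ j ≤ h ] (ι (W m r h (toℕ j)) * q (suc n) (toℕ j))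
        ≈⟨ Whitney-sum h (suc n) ⟩
      p ⟦ r ⟧ (h ℕ.+ suc n)
        ≈⟨ reflexive (≡.cong (p ⟦ r ⟧) (ℕ.+-suc h n)) ⟩
      p ⟦ r ⟧ (suc h ℕ.+ n) ∎
      where
      q : ℕ → ℕ → Carrier
      q n j = u ^ j * p (w j) n
      -- As `w (suc j)` equals `w j + ⟦ m ⟧`, this is the recurrence of `p` at `w j`, multiplied by
      -- `u ^ j`.
      q-suc : ∀ j → w j * q n j + q n (suc j) ≈ q (suc n) j
      q-suc j = begin
        w j * (u ^ j * p (w j) n) + u * u ^ j * p (w (suc j)) n
          ≈⟨ +-congˡ (*-congˡ (p-cong n (solve 3 (λ r j m → r :+ (con 1 :+ j) :* m := r :+ j :* m :+ m) refl
               ⟦ r ⟧ ⟦ j ⟧ ⟦ m ⟧))) ⟩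
        w j * (u ^ j * p (w j) n) + u * u ^ j * p (w j + ⟦ m ⟧) n
          ≈⟨ solve 5 (λ w v p u p′ → w :* (v :* p) :+ u :* v :* p′ := v :* (w :* p :+ u :* p′)) refl
               (w j) (u ^ j) (p (w j) n) u (p (w j + ⟦ m ⟧) n) ⟩
        q (suc n) j ∎

    𝓓≈p : ∀ n → 𝓓 m r n u ≈ p ⟦ r ⟧ n
    𝓓≈p n = begin
      ∑[ k ≤ n ] (ι (W m r n (toℕ k)) * u ^ toℕ k)
        -- The inserted `1#` is `p (w k) 0`.
        ≈⟨ ∑-cong-≤ n (λ {k} _ → *-congˡ {ι (W m r n k)} (sym (*-identityʳ (u ^ k)))) ⟩
      ∑[ k ≤ n ] (ι (W m r n (toℕ k)) * (u ^ toℕ k * 1#))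
        ≈⟨ Whitney-sum n 0 ⟩
      p ⟦ r ⟧ (n ℕ.+ 0)
        ≈⟨ reflexive (≡.cong (p ⟦ r ⟧) (ℕ.+-identityʳ n)) ⟩
      p ⟦ r ⟧ n ∎

    addition-formula : ∀ n h → 𝓓 m r (n ℕ.+ h) u ≈
      ∑[ k ≤ n ] ∑[ j ≤ h ]
        (⟦ n C toℕ k ⟧ * 𝓓 m r (toℕ k) u * ι (W m r h (toℕ j)) * u ^ toℕ j
          * ⟦ toℕ j ⟧ ^ (n ∸ toℕ k) * ⟦ m ⟧ ^ (n ∸ toℕ k))
    addition-formula n h = begin
      𝓓 m r (n ℕ.+ h) u
        ≈⟨ 𝓓≈p (n ℕ.+ h) ⟩
      p ⟦ r ⟧ (n ℕ.+ h)
        ≈⟨ reflexive (≡.cong (p ⟦ r ⟧) (ℕ.+-comm n h)) ⟩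
      p ⟦ r ⟧ (h ℕ.+ n)
        ≈⟨ Whitney-sum h n ⟨
      ∑[ j ≤ h ] (ι (W m r h (toℕ j)) * (u ^ toℕ j * p (w (toℕ j)) n))
        ≈⟨ ∑-cong-≤ h expand ⟩
      ∑[ j ≤ h ] ∑[ k ≤ n ] term (toℕ k) (toℕ j)
        ≈⟨ ∑-comm {suc h} {suc n} (λ j k → term (toℕ k) (toℕ j)) ⟩
      ∑[ k ≤ n ] ∑[ j ≤ h ] term (toℕ k) (toℕ j) ∎
      where
      term : ℕ → ℕ → Carrier
      term k j = ⟦ n C k ⟧ * 𝓓 m r k u * ι (W m r h j) * u ^ j * ⟦ j ⟧ ^ (n ∸ k) * ⟦ m ⟧ ^ (n ∸ k)

      expand : ∀ {j} → j ≤ h →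
               ι (W m r h j) * (u ^ j * p (w j) n) ≈ ∑[ k ≤ n ] term (toℕ k) j
      expand {j} _ = begin
        a * (v * p (w j) n)
          -- Since `w j` is `⟦ r ⟧ + jm` by definition, the shift is taken with `c = jm`.
          ≈⟨ *-congˡ (*-congˡ (p-shift jm n ⟦ r ⟧)) ⟨
        a * (v * ∑[ k ≤ n ] b (toℕ k))
          ≈⟨ *-assoc _ _ _ ⟨
        a * v * ∑[ k ≤ n ] b (toℕ k)
          ≈⟨ *-distribˡ-sum {suc n} (a * v) (λ k → b (toℕ k)) ⟩
        ∑[ k ≤ n ] (a * v * b (toℕ k))
          ≈⟨ ∑-cong-≤ n (λ {k} _ → begin
               a * v * (⟦ n C k ⟧ * jm ^ (n ∸ k) * p ⟦ r ⟧ k)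
                 -- The power of `jm` also splits at exponent 0, where every power is `1#`; at
                 -- `j = 0`, `k = n` this is the convention 0^0 = 1.
                 ≈⟨ *-congˡ (*-cong
                      (*-congˡ (CommExp.^-distrib-* commutativeSemiring ⟦ j ⟧ ⟦ m ⟧ (n ∸ k))) (sym (𝓓≈p k))) ⟩
               a * v * (⟦ n C k ⟧ * (⟦ j ⟧ ^ (n ∸ k) * ⟦ m ⟧ ^ (n ∸ k)) * 𝓓 m r k u)
                 ≈⟨ solve 6 (λ a v b x y d → a :* v :* (b :* (x :* y) :* d) := b :* d :* a :* v :* x :* y) refl
                      a v ⟦ n C k ⟧ (⟦ j ⟧ ^ (n ∸ k)) (⟦ m ⟧ ^ (n ∸ k)) (𝓓 m r k u) ⟩
               term k j ∎) ⟩
        ∑[ k ≤ n ] term (toℕ k) j ∎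
        where
        a v jm : Carrier
        a = ι (W m r h j)
        v = u ^ j
        jm = ⟦ j ⟧ * ⟦ m ⟧
        b : ℕ → Carrier
        b k = pascal jm n k * p ⟦ r ⟧ k

mainTheorem5 : ∀ {c ℓ} (R : CommutativeRing c ℓ) (ι : ℚ → CommutativeRing.Carrier R) →
    IsRingHomomorphism +-*-rawRing (CommutativeRing.rawRing R) ι →
    let open CommutativeRing R in
    let open Dowling R ι in
    ∀ (u : Carrier) (m n h r : ℕ) .{{_ : NonZero m}} →
    𝓓 m r (n ℕ.+ h) u ≈
    ∑[ k ≤ n ] ∑[ j ≤ h ]
    (⟦ n C toℕ k ⟧ * 𝓓 m r (toℕ k) u * ι (W m r h (toℕ j)) * u ^ toℕ j
    * ⟦ toℕ j ⟧ ^ (n ∸ toℕ k) * ⟦ m ⟧ ^ (n ∸ toℕ k))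
mainTheorem5 R ι ι-hom u m n h r = Umbral.addition-formula R ι ι-hom u m r n h
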